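{- Let $G$ be a finite non-abelian group with an abelian subgroup $H$ of index $2$, and let $S\subseteq G\setminus\{1_G\}$ be inverse-closed. If $S$ is closed under conjugation in $G$, then $\mathrm{Cay}(G,S)$ is a Cayley graph of an abelian group.
   Context: For a group $G$ and an inverse-closed subset $S\subseteq G\setminus\{1_G\}$, $\mathrm{Cay}(G,S)$ is the graph with vertex set $G$ in which $g\sim h$ if and only if $hg^{ -1}\in S$. A graph $X$ is a Cayley graph of a group $K$ if $X\cong\mathrm{Cay}(K,S')$ for some inverse-closed $S'\subseteq K\setminus\{1_K\}$. -}

module Defs where

open import Level using (Level; _⊔_) renaming (suc to lsuc)
open import Algebra.Bundles using (Group)
import Algebra.Properties.Group as GroupProperties
open import Data.Fin.Base using (Fin)
open import Data.Nat.Base using (ℕ)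
open import Data.Product.Base using (∃; Σ-syntax; _,_)
open import Function.Bundles using (Inverse; _⇔_)
open import Relation.Binary.Bundles using (Setoid)
open import Relation.Binary.Core using (Rel)
open import Relation.Binary.Definitions
  using (Irreflexive; Symmetric; _Respects_; _Respects₂_)
import Relation.Binary.PropositionalEquality as ≡
import Relation.Binary.Reasoning.Setoid as SetoidReasoning
open import Relation.Unary using (Pred; _∈_; _∉_)

private
  variable
    a c ℓ a′ c′ ℓ′ p : Level

HasCardinality : Setoid c ℓ → ℕ → Set (c ⊔ ℓ)
HasCardinality A n = Inverse A (≡.setoid (Fin n))

Finite : Setoid c ℓ → Set (c ⊔ ℓ)
Finite A = ∃ (HasCardinality A)

-- Equality of vertices is a setoid equality, so that the elements of any
-- Group can serve as vertices.
record Graph c ℓ a : Set (lsuc (c ⊔ ℓ ⊔ a)) where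
  field
    vertices : Setoid c ℓ

  open Setoid vertices public using (_≈_) renaming (Carrier to Vertex)

  field
    _~_      : Rel Vertex a
    ~-resp-≈ : _~_ Respects₂ _≈_
    ~-sym    : Symmetric _~_
    ~-irrefl : Irreflexive _≈_ _~_

record _≅_ (X : Graph c ℓ a) (Y : Graph c′ ℓ′ a′)
  : Set (c ⊔ ℓ ⊔ a ⊔ c′ ⊔ ℓ′ ⊔ a′) where
  private
    module X = Graph X
    module Y = Graph Y
  field
    bijection : Inverse X.vertices Y.vertices
  open Inverse bijection public using (to)
  field
    adjacency : ∀ x y → (x X.~ y) ⇔ (to x Y.~ to y)

module _ (G : Group c ℓ) where
  open Group G
  open GroupProperties G

  private
    quotient-inverse : ∀ g h → (h ∙ g ⁻¹) ⁻¹ ≈ g ∙ h ⁻¹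
    quotient-inverse g h =
      trans (⁻¹-anti-homo-∙ h (g ⁻¹)) (∙-congʳ (⁻¹-involutive g))

    quotient-compose : ∀ g h k → (k ∙ h ⁻¹) ∙ (h ∙ g ⁻¹) ≈ k ∙ g ⁻¹
    quotient-compose g h k = begin
      (k ∙ h ⁻¹) ∙ (h ∙ g ⁻¹)  ≈⟨ assoc k (h ⁻¹) (h ∙ g ⁻¹) ⟩
      k ∙ (h ⁻¹ ∙ (h ∙ g ⁻¹))  ≈⟨ ∙-congˡ (assoc (h ⁻¹) h (g ⁻¹)) ⟨
      k ∙ ((h ⁻¹ ∙ h) ∙ g ⁻¹)  ≈⟨ ∙-congˡ (∙-congʳ (inverseˡ h)) ⟩
      k ∙ (ε ∙ g ⁻¹)           ≈⟨ ∙-congˡ (identityˡ (g ⁻¹)) ⟩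
      k ∙ g ⁻¹                 ∎
      where open SetoidReasoning setoid

  record Subgroup p : Set (c ⊔ ℓ ⊔ lsuc p) where
    field
      member    : Pred Carrier p
      resp-≈    : member Respects _≈_
      ε-closed  : ε ∈ member
      ∙-closed  : ∀ {x y} → x ∈ member → y ∈ member → x ∙ y ∈ member
      ⁻¹-closed : ∀ {x} → x ∈ member → x ⁻¹ ∈ member

  IsAbelianSubgroup : Subgroup p → Set (c ⊔ ℓ ⊔ p)
  IsAbelianSubgroup H =
    ∀ {x y} → x ∈ member → y ∈ member → x ∙ y ≈ y ∙ x
    where open Subgroup H

  -- G modulo H g = H h, which holds exactly when h ∙ g ⁻¹ lies in H.
  rightCosets : Subgroup p → Setoid c p
  rightCosets H = record
    { Carrier = Carrier
    ; _≈_     = λ g h → h ∙ g ⁻¹ ∈ member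
    ; isEquivalence = record
      { refl  = λ {g} → resp-≈ (sym (inverseʳ g)) ε-closed
      ; sym   = λ {g} {h} q → resp-≈ (quotient-inverse g h) (⁻¹-closed q)
      ; trans = λ {g} {h} {k} q r →
          resp-≈ (quotient-compose g h k) (∙-closed r q)
      }
    }
    where open Subgroup H

  HasIndex : Subgroup p → ℕ → Set (c ⊔ p)
  HasIndex H n = HasCardinality (rightCosets H) n

  record ConnectionSet p : Set (c ⊔ ℓ ⊔ lsuc p) where
    field
      member    : Pred Carrier p
      resp-≈    : member Respects _≈_
      ε-free    : ε ∉ member
      ⁻¹-closed : ∀ {s} → s ∈ member → s ⁻¹ ∈ member

  ConjugationClosed : ConnectionSet p → Set (c ⊔ p)
  ConjugationClosed S = ∀ g {s} → s ∈ member → (g ∙ s) ∙ g ⁻¹ ∈ member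
    where open ConnectionSet S

  Cay : ConnectionSet p → Graph c ℓ p
  Cay S = record
    { vertices = setoid
    ; _~_      = λ g h → h ∙ g ⁻¹ ∈ member
    ; ~-resp-≈ = (λ h≈h′ → resp-≈ (∙-congʳ h≈h′))
               , (λ g≈g′ → resp-≈ (∙-congˡ (⁻¹-cong g≈g′)))
    ; ~-sym    = λ {g} {h} q → resp-≈ (quotient-inverse g h) (⁻¹-closed q)
    ; ~-irrefl = λ {g} {h} g≈h q →
        ε-free (resp-≈ (trans (∙-congʳ (sym g≈h)) (inverseʳ g)) q)
    }
    where open ConnectionSet S

IsCayleyGraphOf : Graph c ℓ a → Group c′ ℓ′ → Set (c ⊔ ℓ ⊔ lsuc a ⊔ c′ ⊔ ℓ′)
IsCayleyGraphOf {a = a} X K = Σ[ S ∈ ConnectionSet K a ] (X ≅ Cay K S)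

{-# OPTIONS --safe #-}

-- Pick a transversal of H whose elements commute pairwise (for index 2 it
-- consists of ε and one further element), and write x = π x ∙ τ x with
-- π x ∈ H and τ x in the transversal.  The operation x * y = π x ∙ y ∙ τ x
-- makes the set G an abelian group: it is commutative because the π's
-- commute and the τ's commute, and for the same reason the left translations
-- commute, which then gives associativity.  Moreover
-- (g * w) ∙ g⁻¹ = π g ∙ w ∙ (π g)⁻¹, so that for conjugation-closed S the
-- identity map is an isomorphism of the two Cayley graphs with connection
-- set S.

module Submission where

open import Defs
open import Algebra.Bundles using (Group; AbelianGroup)
open import Algebra.Definitions using (Commutative)
import Algebra.Consequences.Setoid as Consequences
import Algebra.Properties.AbelianGroup as AbelianGroupProperties
import Algebra.Properties.Group as GroupProperties
import Algebra.Properties.Semigroup as SemigroupProperties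
open import Data.Fin.Base using (Fin; zero; suc; punchOut)
open import Data.Fin.Properties using (_≟_; punchOut-injective)
open import Data.Product.Base using (Σ-syntax; _,_)
import Function.Construct.Identity as Identity
open import Function.Bundles using (Inverse; mk⇔)
open import Relation.Binary.PropositionalEquality.Core as ≡ using (_≡_; _≢_)
open import Relation.Binary.Bundles using (Setoid)
import Relation.Binary.Reasoning.Setoid as SetoidReasoning
open import Relation.Nullary.Decidable.Core using (yes; no)
open import Relation.Nullary.Negation.Core using (¬_)
open import Relation.Unary using (_∈_)

module _ {c ℓ} (G : Group c ℓ) where

  open Group G

  module CommutingFactorisation
    (π τ : Carrier → Carrier)
    (π-cong : ∀ {x y} → x ≈ y → π x ≈ π y)
    (τ-cong : ∀ {x y} → x ≈ y → τ x ≈ τ y)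
    (π∙τ≈id : ∀ x → π x ∙ τ x ≈ x)
    (π-comm : ∀ x y → π x ∙ π y ≈ π y ∙ π x)
    (τ-comm : ∀ x y → τ x ∙ τ y ≈ τ y ∙ τ x)
    where

    open GroupProperties G
    open SemigroupProperties semigroup
    open Consequences setoid
    open SetoidReasoning setoid

    infixl 7 _*_
    _*_ : Carrier → Carrier → Carrier
    x * y = (π x ∙ y) ∙ τ x

    -- Solving `(π x ∙ y) ∙ τ x ≈ ε` gives `π x ⁻¹ ∙ τ x ⁻¹`. Writing `π x ⁻¹` as `τ x ∙ x ⁻¹`
    -- exhibits the solution as a conjugate of `x ⁻¹`.
    inv : Carrier → Carrier
    inv x = (τ x ∙ x ⁻¹) ∙ τ x ⁻¹

    *-cong : ∀ {x y u v} → x ≈ y → u ≈ v → x * u ≈ y * v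
    *-cong x≈y u≈v = ∙-cong (∙-cong (π-cong x≈y) u≈v) (τ-cong x≈y)

    inv-cong : ∀ {x y} → x ≈ y → inv x ≈ inv y
    inv-cong x≈y =
      ∙-cong (∙-cong (τ-cong x≈y) (⁻¹-cong x≈y)) (⁻¹-cong (τ-cong x≈y))

    *-factors : ∀ x y → x * y ≈ (π x ∙ π y) ∙ (τ y ∙ τ x)
    *-factors x y = begin
      (π x ∙ y) ∙ τ x              ≈⟨ ∙-congʳ (∙-congˡ (π∙τ≈id y)) ⟨
      (π x ∙ (π y ∙ τ y)) ∙ τ x    ≈⟨ [u∙vw]x≈uv∙wx (π x) (π y) (τ y) (τ x) ⟩
      (π x ∙ π y) ∙ (τ y ∙ τ x)    ∎

    *-comm : ∀ x y → x * y ≈ y * x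
    *-comm x y = begin
      x * y                        ≈⟨ *-factors x y ⟩
      (π x ∙ π y) ∙ (τ y ∙ τ x)    ≈⟨ ∙-cong (π-comm x y) (τ-comm y x) ⟩
      (π y ∙ π x) ∙ (τ x ∙ τ y)    ≈⟨ *-factors y x ⟨
      y * x                        ∎

    *-*-translation : ∀ x y z → x * (y * z) ≈ ((π x ∙ π y) ∙ z) ∙ (τ y ∙ τ x)
    *-*-translation x y z = begin
      (π x ∙ ((π y ∙ z) ∙ τ y)) ∙ τ x
        ≈⟨ [u∙vw]x≈uv∙wx (π x) (π y ∙ z) (τ y) (τ x) ⟩
      (π x ∙ (π y ∙ z)) ∙ (τ y ∙ τ x)
        ≈⟨ ∙-congʳ (assoc (π x) (π y) z) ⟨
      ((π x ∙ π y) ∙ z) ∙ (τ y ∙ τ x)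
        ∎

    *-translations-commute : ∀ x y z → x * (y * z) ≈ y * (x * z)
    *-translations-commute x y z = begin
      x * (y * z)                      ≈⟨ *-*-translation x y z ⟩
      ((π x ∙ π y) ∙ z) ∙ (τ y ∙ τ x)  ≈⟨ ∙-cong (∙-congʳ (π-comm x y)) (τ-comm y x) ⟩
      ((π y ∙ π x) ∙ z) ∙ (τ x ∙ τ y)  ≈⟨ *-*-translation y x z ⟨
      y * (x * z)                      ∎

    -- Commutativity moves `x * y` into the right argument, so that `π (x * y)` and `τ (x * y)`
    -- never have to be computed.
    *-assoc : ∀ x y z → (x * y) * z ≈ x * (y * z)
    *-assoc x y z = begin
      (x * y) * z    ≈⟨ *-comm (x * y) z ⟩
      z * (x * y)    ≈⟨ *-translations-commute z x y ⟩
      x * (z * y)    ≈⟨ *-cong refl (*-comm z y) ⟩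
      x * (y * z)    ∎

    *-identityʳ : ∀ x → x * ε ≈ x
    *-identityʳ x = trans (∙-congʳ (identityʳ (π x))) (π∙τ≈id x)

    *-inverseʳ : ∀ x → x * inv x ≈ ε
    *-inverseʳ x = begin
      (π x ∙ ((τ x ∙ x ⁻¹) ∙ τ x ⁻¹)) ∙ τ x
        ≈⟨ assoc (π x) ((τ x ∙ x ⁻¹) // τ x) (τ x) ⟩
      π x ∙ (((τ x ∙ x ⁻¹) // τ x) ∙ τ x)
        ≈⟨ ∙-congˡ (//-rightDividesˡ (τ x) (τ x ∙ x ⁻¹)) ⟩
      π x ∙ (τ x ∙ x ⁻¹)
        ≈⟨ uv≈w⇒u∙vx≈wx (π∙τ≈id x) (x ⁻¹) ⟩
      x ∙ x ⁻¹
        ≈⟨ inverseʳ x ⟩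
      ε
        ∎

    abelianGroup : AbelianGroup c ℓ
    abelianGroup = record
      { _≈_ = _≈_
      ; _∙_ = _*_
      ; ε   = ε
      ; _⁻¹ = inv
      ; isAbelianGroup = record
        { isGroup = record
          { isMonoid = record
            { isSemigroup = record
              { isMagma = record { isEquivalence = isEquivalence ; ∙-cong = *-cong }
              ; assoc   = *-assoc
              }
            ; identity = comm∧idʳ⇒id *-comm *-identityʳ
            }
          ; inverse = comm∧invʳ⇒inv *-comm *-inverseʳ
          ; ⁻¹-cong = inv-cong
          }
        ; comm = *-comm
        }
      }

    τ//id≈π⁻¹ : ∀ g → τ g // g ≈ π g ⁻¹
    τ//id≈π⁻¹ g = inverseʳ-unique (π g) (τ g // g) (begin
      π g ∙ (τ g // g)    ≈⟨ uv≈w⇒u∙vx≈wx (π∙τ≈id g) (g ⁻¹) ⟩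
      g ∙ g ⁻¹            ≈⟨ inverseʳ g ⟩
      ε                   ∎)

    -- The factor `τ g` that `g * w` carries on the right turns `g ⁻¹` into `π g ⁻¹`.
    *-//-conjugate : ∀ g w → (g * w) // g ≈ (π g ∙ w) ∙ π g ⁻¹
    *-//-conjugate g w = begin
      ((π g ∙ w) ∙ τ g) ∙ g ⁻¹    ≈⟨ assoc (π g ∙ w) (τ g) (g ⁻¹) ⟩
      (π g ∙ w) ∙ (τ g // g)      ≈⟨ ∙-congˡ (τ//id≈π⁻¹ g) ⟩
      (π g ∙ w) ∙ π g ⁻¹          ∎

    -- Adjacency in the two Cayley graphs tests `h // g` and `h * inv g`; being conjugate in `G`,
    -- these lie in a conjugation-closed set together. The witness `w = h * inv g` is chosen so that
    -- `g * w ≈ h`.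
    quotients-conjugate : ∀ g h → h // g ≈ (π g ∙ (h * inv g)) ∙ π g ⁻¹
    quotients-conjugate g h = begin
      h // g                          ≈⟨ ∙-congʳ g*[h*g⁻¹]≈h ⟨
      (g * (h * inv g)) // g          ≈⟨ *-//-conjugate g (h * inv g) ⟩
      (π g ∙ (h * inv g)) ∙ π g ⁻¹    ∎
      where
      g*[h*g⁻¹]≈h : g * (h * inv g) ≈ h
      g*[h*g⁻¹]≈h = trans (sym (*-assoc g h (inv g)))
        (AbelianGroupProperties.xyx⁻¹≈y abelianGroup g h)

    -- The double inverse is the form in which `ConjugationClosed` delivers conjugation by `x ⁻¹`.
    conjugate-cancel : ∀ x w → (x ⁻¹ ∙ ((x ∙ w) ∙ x ⁻¹)) ∙ x ⁻¹ ⁻¹ ≈ w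
    conjugate-cancel x w = begin
      (x ⁻¹ ∙ ((x ∙ w) // x)) // x ⁻¹    ≈⟨ ∙-congʳ (assoc (x ⁻¹) (x ∙ w) (x ⁻¹)) ⟨
      ((x \\ (x ∙ w)) // x) // x ⁻¹      ≈⟨ //-rightDividesʳ (x ⁻¹) (x \\ (x ∙ w)) ⟩
      x \\ (x ∙ w)                       ≈⟨ \\-leftDividesʳ x w ⟩
      w                                  ∎

    Cay-isCayleyGraphOf-abelianGroup :
      ∀ {q} (S : ConnectionSet G q) → ConjugationClosed G S →
      IsCayleyGraphOf (Cay G S) (AbelianGroup.group abelianGroup)
    Cay-isCayleyGraphOf-abelianGroup S conj = S* , record
      { bijection = Identity.inverse setoid
      ; adjacency = λ g h → mk⇔
          (λ q → resp-≈
            (trans (∙-congʳ (∙-congˡ (quotients-conjugate g h)))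
                   (conjugate-cancel (π g) (h * inv g)))
            (conj (π g ⁻¹) q))
          (λ q → resp-≈ (sym (quotients-conjugate g h)) (conj (π g) q))
      }
      where
      open ConnectionSet S
      S* : ConnectionSet (AbelianGroup.group abelianGroup) _
      S* = record
        { member    = member
        ; resp-≈    = resp-≈
        ; ε-free    = ε-free
        -- `inv s` is, by definition, the conjugate of `s ⁻¹` by `τ s`.
        ; ⁻¹-closed = λ {s} s∈S → conj (τ s) (⁻¹-closed s∈S)
        }

Fin1-irrelevant : (i j : Fin 1) → i ≡ j
Fin1-irrelevant zero zero = ≡.refl

-- Punching `i` out of `Fin 2` leaves `Fin 1`, where the images of `j` and `k` coincide.
≢⇒≡-Fin2 : {i j k : Fin 2} → i ≢ j → i ≢ k → j ≡ k
≢⇒≡-Fin2 i≢j i≢k = punchOut-injective i≢j i≢k (Fin1-irrelevant _ _)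

module IndexTwo {c ℓ p} (G : Group c ℓ) (H : Subgroup G p)
  (index : HasIndex G H 2) where

  open Group G renaming (inverseʳ to ∙-inverseʳ)
  open Subgroup H using (member; resp-≈; ε-closed)
  open Inverse index using (to; from; to-cong; inverseʳ)
  private module Coset = Setoid (rightCosets G H)

  -- The trivial coset gets `ε` instead of `from (to ε)`, an element of `H` that might not commute
  -- with the other representative.
  representative : Fin 2 → Carrier
  representative i with to ε ≟ i
  ... | yes _ = ε
  ... | no  _ = from i

  representative-coset : ∀ {i x} → i ≡ to x → representative i Coset.≈ x
  representative-coset {i} i≡to-x with to ε ≟ i
  ... | yes to-ε≡i =
    -- Both `ε` and `x` lie in the coset of `from (to ε)`.
    Coset.trans (Coset.sym (inverseʳ ≡.refl)) (inverseʳ (≡.trans to-ε≡i i≡to-x))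
  ... | no  _      = inverseʳ i≡to-x

  representative-comm :
    ∀ i j → representative i ∙ representative j ≈ representative j ∙ representative i
  representative-comm i j with to ε ≟ i | to ε ≟ j
  ... | yes _   | _       = trans (identityˡ _) (sym (identityʳ _))
  ... | no _    | yes _   = trans (identityʳ _) (sym (identityˡ _))
  -- Only one index differs from `to ε`, so the two representatives are the same element.
  ... | no ε≢i  | no ε≢j  =
    reflexive (≡.cong₂ (λ k l → from k ∙ from l) i≡j (≡.sym i≡j))
    where i≡j = ≢⇒≡-Fin2 ε≢i ε≢j

  to-resp-≈ : ∀ {x y} → x ≈ y → to x ≡ to y
  to-resp-≈ {x} x≈y =
    to-cong (resp-≈ (trans (sym (∙-inverseʳ x)) (∙-congʳ x≈y)) ε-closed)

  transversalPart : Carrier → Carrier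
  transversalPart x = representative (to x)

  transversalPart-cong : ∀ {x y} → x ≈ y → transversalPart x ≈ transversalPart y
  transversalPart-cong x≈y = reflexive (≡.cong representative (to-resp-≈ x≈y))

  subgroupPart : Carrier → Carrier
  subgroupPart x = x // transversalPart x

  -- For right cosets, `representative (to x) Coset.≈ x` unfolds to exactly this membership.
  subgroupPart∈H : ∀ x → subgroupPart x ∈ member
  subgroupPart∈H x = representative-coset ≡.refl

lemma5p2 : ∀ {c ℓ p q} (G : Group c ℓ) →
    Finite (Group.setoid G) →
    ¬ Commutative (Group._≈_ G) (Group._∙_ G) →
    (H : Subgroup G p) →
    IsAbelianSubgroup G H →
    HasIndex G H 2 →
    (S : ConnectionSet G q) →
    ConjugationClosed G S →
    Σ[ K ∈ AbelianGroup c ℓ ] IsCayleyGraphOf (Cay G S) (AbelianGroup.group K)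
lemma5p2 G _ _ H H-abelian index S conj =
  abelianGroup , Cay-isCayleyGraphOf-abelianGroup S conj
  where
  open IndexTwo G H index
  open CommutingFactorisation G subgroupPart transversalPart
    (λ x≈y → GroupProperties.//-cong₂ G x≈y (transversalPart-cong x≈y))
    transversalPart-cong
    (λ x → GroupProperties.//-rightDividesˡ G (transversalPart x) x)
    (λ x y → H-abelian (subgroupPart∈H x) (subgroupPart∈H y))
    (λ x y → representative-comm _ _)
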